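{- For every real $r\ge 0$ there exists a finite set $\mathcal{S}_r$ of low-defect pairs such that: (1) each $(f,C)\in\mathcal{S}_r$ has degree at most $\lfloor r\rfloor$; and (2) for every $N\in B_r$ there exists some $(f,C)\in\mathcal{S}_r$ that efficiently $3$-represents $N$.
   Context: $\|n\|$ denotes the complexity of a positive integer $n$: the least number of $1$'s needed to write $n$ using $1$, addition, multiplication and parentheses. The defect is $\delta(n)=\|n\|-3\log_3 n$. A positive integer $n$ is a leader if it is the smallest positive integer with defect $\delta(n)$ (equivalently, either $3\nmid n$, or $3\mid n$ and $\delta(n)<\delta(n/3)$). For real $r\ge0$, $B_r$ is the set of leaders $n$ with $\delta(n)<r$. For polynomials $f_1$ in variables $x_1,\dots,x_{r_1}$ and $f_2$ in $x_1,\dots,x_{r_2}$, define $(f_1\otimes f_2)(x_1,\dots,x_{r_1+r_2})=f_1(x_1,\dots,x_{r_1})f_2(x_{r_1+1},\dots,x_{r_1+r_2})$ (so the variables are relabelled so as to be disjoint); relabelling/permuting variables is regarded as giving the same object. The set of low-defect pairs is the smallest subset $\mathscr{P}$ of $\mathbb{Z}[x_1,x_2,\dots]\times\mathbb{N}$ such that: (i) for every positive integer constant $k$ and every integer $C\ge\|k\|$, $(k,C)\in\mathscr{P}$; (ii) if $(f_1,C_1),(f_2,C_2)\in\mathscr{P}$ then $(f_1\otimes f_2,C_1+C_2)\in\mathscr{P}$; (iii) if $(f,C)\in\mathscr{P}$, $c$ is a positive integer and $D\ge\|c\|$, then $(f\otimes x_1+c,\,C+D)\in\mathscr{P}$ (i.e.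 if $f$ is in $x_1,\dots,x_{r}$ this is $f(x_1,\dots,x_r)x_{r+1}+c$). The polynomials arising are low-defect polynomials; a low-defect polynomial built this way uses variables $x_1,\dots,x_r$ and its degree is $r$, the number of variables; the degree of a pair $(f,C)$ is the degree of $f$. A low-defect pair $(f,C)$ of degree $r$ efficiently $3$-represents $N$ if there are nonnegative integers $n_1,\dots,n_r$ with $N=f(3^{n_1},\dots,3^{n_r})$ and $\|N\|=C+3(n_1+\dots+n_r)$.
   Formalization: The statement is proved for every rational r ≥ 0; the case of real r follows by taking a rational s with r ≤ s < ⌊r⌋+1, since then B_r ⊆ B_s and ⌊s⌋ = ⌊r⌋. -}

module Defs where

open import Data.Nat using (ℕ; zero; suc; _+_; _*_; _^_; _≤_; _<_; NonZero)
open import Data.Nat.DivMod using (_/_)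
open import Data.Product using (Σ; ∃; ∃-syntax; _×_; _,_)
open import Data.Vec using (Vec; take; drop; init; last; map; sum)
open import Data.List using (List)
open import Data.List.Relation.Unary.All using (All)
open import Data.List.Relation.Unary.Any using (Any)
open import Relation.Binary.PropositionalEquality using (_≡_)
open import Relation.Nullary using (¬_)

data Expr : Set where
  one  : Expr
  plus : Expr → Expr → Expr
  times : Expr → Expr → Expr

eval : Expr → ℕ
eval one = 1
eval (plus a b) = eval a + eval b
eval (times a b) = eval a * eval b

ones : Expr → ℕ
ones one = 1
ones (plus a b) = ones a + ones b
ones (times a b) = ones a + ones b

IsComplexity : ℕ → ℕ → Set
IsComplexity n k =
  (Σ Expr λ e → eval e ≡ n × ones e ≡ k) × (∀ e → eval e ≡ n → k ≤ ones e)

-- δ(m) = δ(n)  ⇔  ‖m‖ - 3 log₃ m = ‖n‖ - 3 log₃ n  ⇔  3^‖m‖ n³ = 3^‖n‖ m³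
SameDefect : ℕ → ℕ → Set
SameDefect m n = ∃[ km ] ∃[ kn ]
  (IsComplexity m km × IsComplexity n kn × 3 ^ km * n ^ 3 ≡ 3 ^ kn * m ^ 3)

Leader : ℕ → Set
Leader n = 1 ≤ n × (∀ m → 1 ≤ m → m < n → ¬ SameDefect m n)

-- δ(n) < p/q  ⇔  q‖n‖ < p + 3q log₃ n  ⇔  3^(q‖n‖) < 3^p n^(3q)
DefectBelow : (p q : ℕ) → ℕ → Set
DefectBelow p q n = ∃[ k ] (IsComplexity n k × 3 ^ (q * k) < 3 ^ p * n ^ (3 * q))

InB : (p q : ℕ) → ℕ → Set
InB p q n = Leader n × DefectBelow p q n

-- Derivations of low-defect pairs (f , C); indices: degree r and C.
data LDP : ℕ → ℕ → Set where
  const : (k C c : ℕ) → 1 ≤ k → IsComplexity k c → c ≤ C → LDP 0 C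
  tensor : ∀ {r₁ r₂ C₁ C₂} → LDP r₁ C₁ → LDP r₂ C₂ → LDP (r₁ + r₂) (C₁ + C₂)
  addVar : ∀ {r C} → LDP r C → (c D d : ℕ) → 1 ≤ c → IsComplexity c d → d ≤ D
         → LDP (suc r) (C + D)

poly : ∀ {r C} → LDP r C → Vec ℕ r → ℕ
poly (const k C c _ _ _) xs = k
poly (tensor {r₁} f₁ f₂) xs = poly f₁ (take r₁ xs) * poly f₂ (drop r₁ xs)
poly (addVar f c D d _ _ _) xs = poly f (init xs) * last xs + c

record Pair : Set where
  constructor pair
  field
    deg : ℕ
    cst : ℕ
    ldp : LDP deg cst
open Pair public

EffRep : Pair → ℕ → Set
EffRep (pair r C f) N = Σ (Vec ℕ r) λ ns →
  poly f (map (3 ^_) ns) ≡ N × IsComplexity N (C + 3 * sum ns)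

{-# OPTIONS --safe #-}
module Submission where

open import Defs
open import Data.Nat using (ℕ; zero; suc; _+_; _*_; _^_; _≤_; _<_; _≤?_; _<?_; _≟_;
  z≤n; s≤s; NonZero; >-nonZero; >-nonZero⁻¹)
open import Data.Nat.DivMod using (_/_; m*n/n≡m; /-monoˡ-≤)
open import Data.Nat.Induction using (<-rec)
open import Data.Nat.Properties
open import Data.Nat.Tactic.RingSolver using (solve-∀)
open import Data.Product using (Σ; ∃-syntax; _×_; _,_)
open import Data.Sum using (_⊎_; inj₁; inj₂)
open import Data.List using (List; []; _∷_; _++_; map; cartesianProductWith; upTo)
open import Data.List.Membership.Propositional using (_∈_; find; lose)
open import Data.List.Membership.Propositional.Properties using (∈-++⁺ˡ; ∈-++⁺ʳ; ∈-cartesianProductWith⁺; ∈-map⁺; ∈-upTo⁺)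
open import Data.List.Relation.Unary.All using (All; []; _∷_) renaming (map to mapAll)
import Data.List.Relation.Unary.All as All
import Data.List.Relation.Unary.All.Properties as All
open import Data.List.Relation.Unary.Any using (Any; here; there; any?)
open import Data.Vec using (Vec)
import Data.Vec as Vec
open import Data.Vec.Properties using
  (++-injectiveˡ; ++-injectiveʳ; take++drop≡id; map-++; map-∷ʳ; init-∷ʳ; last-∷ʳ; sum-++)
open import Relation.Binary.PropositionalEquality using (_≡_; _≢_; refl; sym; trans; cong; cong₂; subst; subst₂)
open import Relation.Nullary using (¬_; yes; no; contradiction)
open import Relation.Nullary.Decidable using (_×-dec_; toWitness)
open import Relation.Unary using (Decidable)

-- A positive power of 3 has defect 0, and every other number has defect at least δ(2) = 2 - 3 log₃ 2.  In a most
-- efficient expression u v of a leader neither factor is a power of 3, so both have defect smaller by δ(2); in a + b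
-- with b ≤ a, δ(a) is smaller by δ(2) unless a + b ≤ 3, and ‖b‖ is bounded.  As a = 3ʲ a′ with a′ a leader, induction
-- on k gives finitely many low-defect pairs for the leaders of defect < k δ(2).
--
-- For the degrees: a pair of degree d has limiting defect at least d, approached as soon as all innermost variables are
-- large.  So if d > ⌊r⌋, a number of defect < r needs a bounded value in some innermost variable, and substituting that
-- value leaves a low-defect pair of degree d - 1.

-- Enumeration of expressions and existence of the complexity.

ones≥1 : ∀ e → 1 ≤ ones e
ones≥1 one = ≤-refl
ones≥1 (plus a b) = ≤-trans (ones≥1 a) (m≤m+n _ _)
ones≥1 (times a b) = ≤-trans (ones≥1 a) (m≤m+n _ _)

eval≥1 : ∀ e → 1 ≤ eval e
eval≥1 one = ≤-refl
eval≥1 (plus a b) = ≤-trans (eval≥1 a) (m≤m+n _ _)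
eval≥1 (times a b) = *-mono-≤ (eval≥1 a) (eval≥1 b)

-- `n` bounds the depth, which keeps the recursion structural. An expression is never deeper than
-- its number of ones, so all those with at most `n` ones are included.
exprs : ℕ → List Expr
exprs zero = []
exprs (suc n) = one ∷ (cartesianProductWith plus (exprs n) (exprs n)
                       ++ cartesianProductWith times (exprs n) (exprs n))

summands≤ : ∀ {a b n} → 1 ≤ a → 1 ≤ b → a + b ≤ suc n → a ≤ n × b ≤ n
summands≤ {a} {b} 1≤a 1≤b a+b≤1+n =
  ≤-pred (≤-trans (≤-trans (≤-reflexive (sym (+-comm a 1))) (+-monoʳ-≤ a 1≤b)) a+b≤1+n) ,
  ≤-pred (≤-trans (+-monoˡ-≤ b 1≤a) a+b≤1+n)

∈-exprs : ∀ e {n} → ones e ≤ n → e ∈ exprs n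
∈-exprs e {zero} h = contradiction (≤-trans (ones≥1 e) h) λ ()
∈-exprs one {suc n} h = here refl
∈-exprs (plus a b) {suc n} h =
  let a≤n , b≤n = summands≤ (ones≥1 a) (ones≥1 b) h in
  there (∈-++⁺ˡ (∈-cartesianProductWith⁺ plus (∈-exprs a a≤n) (∈-exprs b b≤n)))
∈-exprs (times a b) {suc n} h =
  let a≤n , b≤n = summands≤ (ones≥1 a) (ones≥1 b) h in
  there (∈-++⁺ʳ (cartesianProductWith plus (exprs n) (exprs n))
    (∈-cartesianProductWith⁺ times (∈-exprs a a≤n) (∈-exprs b b≤n)))

-- The bound on the ones makes the search finite; a witness that is found may still use more than
-- `n` ones.
search : ∀ {P : Expr → Set} → Decidable P → ∀ n →
         (Σ Expr P) ⊎ (∀ e → ones e ≤ n → ¬ P e)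
search P? n with any? P? (exprs n)
... | yes p = let e , _ , Pe = find p in inj₁ (e , Pe)
... | no ¬p = inj₂ λ e h Pe → ¬p (lose (∈-exprs e h) Pe)

-- Well-founded descent: pass to a cheaper expression of equal value until the search finds none.
complexity-exists : ∀ e → ∃[ k ] (IsComplexity (eval e) k × k ≤ ones e)
complexity-exists e = <-rec P step (ones e) e refl
  where
  P : ℕ → Set
  P c = ∀ e → ones e ≡ c → ∃[ k ] (IsComplexity (eval e) k × k ≤ ones e)
  step : ∀ c → (∀ {c'} → c' < c → P c') → P c
  step c rec e refl with search (λ e' → (eval e' ≟ eval e) ×-dec (ones e' <? ones e)) (ones e)
  ... | inj₁ (e' , eq , lt) =
    let k , kc , k≤ = rec lt e' refl in
    k , subst (λ n → IsComplexity n k) eq kc , ≤-trans k≤ (<⇒≤ lt)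
  ... | inj₂ none = ones e , ((e , refl , refl) , minimal) , ≤-refl
    where
    minimal : ∀ e' → eval e' ≡ eval e → ones e ≤ ones e'
    minimal e' eq with ones e ≤? ones e'
    ... | yes h = h
    ... | no ¬h = contradiction (eq , ≰⇒> ¬h) (none e' (<⇒≤ (≰⇒> ¬h)))

-- Leaders and the removal of factors 3.

three : Expr
three = plus one (plus one one)

times-threes : ℕ → Expr → Expr
times-threes zero e = e
times-threes (suc j) e = times three (times-threes j e)

eval-times-threes : ∀ j e → eval (times-threes j e) ≡ 3 ^ j * eval e
eval-times-threes zero e = sym (*-identityˡ (eval e))
eval-times-threes (suc j) e = trans (cong (3 *_) (eval-times-threes j e)) (sym (*-assoc 3 (3 ^ j) (eval e)))

ones-times-threes : ∀ j e → ones (times-threes j e) ≡ 3 * j + ones e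
ones-times-threes zero e = refl
ones-times-threes (suc j) e = trans (cong (3 +_) (ones-times-threes j e))
  (trans (sym (+-assoc 3 (3 * j) (ones e))) (cong (_+ ones e) (sym (*-suc 3 j))))

-- All that is used of a leader n, with c = ‖n‖.
Tripling-free : ℕ → ℕ → Set
Tripling-free n c = ∀ e → n ≡ 3 * eval e → c ≢ 3 + ones e

minimal-third : ∀ {n c} e → IsComplexity n c → n ≡ 3 * eval e → c ≡ 3 + ones e →
                IsComplexity (eval e) (ones e)
minimal-third e (_ , min) refl refl = (e , refl , refl) , λ e' q →
  +-cancelˡ-≤ 3 _ _ (min (times three e') (cong (3 *_) q))

-- Removing a factor 3 at a saving of exactly three ones leaves the defect unchanged, so `eval e`
-- would be a smaller number of the same defect.
leader⇒tripling-free : ∀ {n c} → IsComplexity n c → Leader n → Tripling-free n c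
leader⇒tripling-free ck (_ , smallest) e refl refl =
  smallest (eval e) (eval≥1 e) (m<m+n (eval e) (≤-trans (eval≥1 e) (m≤m+n _ _)))
    (ones e , 3 + ones e , minimal-third e ck refl refl , ck , same (3 ^ ones e) (eval e))
  where
  same : ∀ x m → x * ((3 * m) * ((3 * m) * ((3 * m) * 1))) ≡ 3 * (3 * (3 * x)) * (m * (m * (m * 1)))
  same = solve-∀

-- Each factor 3 removed lowers the complexity by 3, so the removal terminates.
strip-threes : ∀ {n c} → IsComplexity n c →
  ∃[ j ] ∃[ m ] ∃[ d ] (n ≡ 3 ^ j * m × c ≡ 3 * j + d × IsComplexity m d × Tripling-free m d)
strip-threes {n} {c} = <-rec P step c n
  where
  P : ℕ → Set
  P c = ∀ n → IsComplexity n c →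
    ∃[ j ] ∃[ m ] ∃[ d ] (n ≡ 3 ^ j * m × c ≡ 3 * j + d × IsComplexity m d × Tripling-free m d)
  step : ∀ c → (∀ {c'} → c' < c → P c') → P c
  step c rec n ck with search (λ e → (n ≟ 3 * eval e) ×-dec (c ≟ 3 + ones e)) c
  ... | inj₂ none = 0 , n , c , sym (*-identityˡ n) , refl , ck ,
        λ e p q → none e (≤-trans (m≤n+m (ones e) 3) (≤-reflexive (sym q))) (p , q)
  ... | inj₁ (e , refl , refl) with rec (m<n+m (ones e) {3} (s≤s z≤n)) (eval e) (minimal-third e ck refl refl)
  ... | j , m , d , p , q , mk , tf =
        suc j , m , d , trans (cong (3 *_) p) (sym (*-assoc 3 (3 ^ j) m)) ,
        trans (cong (3 +_) q) (trans (sym (+-assoc 3 (3 * j) d)) (cong (_+ d) (sym (*-suc 3 j)))) , mk , tf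

-- The gap between defect 0 and δ(2), and the descent by δ(2).

^-distribʳ-* : ∀ n x y → (x * y) ^ n ≡ x ^ n * y ^ n
^-distribʳ-* zero x y = refl
^-distribʳ-* (suc n) x y = trans (cong (x * y *_) (^-distribʳ-* n x y)) (lem x y (x ^ n) (y ^ n))
  where
  lem : ∀ a b c d → a * b * (c * d) ≡ a * c * (b * d)
  lem = solve-∀

-- δ(n) ≥ δ(m) + δ(2), where ‖m‖ = d, ‖n‖ = c and 3^{δ(2)} = 9/8.
Increases : (m d n c : ℕ) → Set
Increases m d n c = 9 * n ^ 3 * 3 ^ d ≤ 8 * (m ^ 3 * 3 ^ c)

-- As a + b ≤ 2a, the term 3 log₃ grows by at most 3 log₃ 2, so two ones in `b` suffice for 2 - 3
-- log₃ 2. If `b` is `one` and a ≥ 3, then a + 1 ≤ 4a/3, and the gain 1 - 3 log₃(4/3) is still more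
-- than δ(2).
sum-increases : ∀ a b → eval b ≤ eval a →
  (ones b ≡ 1 × eval b ≡ 1 × eval a ≤ 2) ⊎
  Increases (eval a) (ones a) (eval a + eval b) (ones a + ones b)
sum-increases a b b≤a with 2 ≤? ones b
... | yes 2≤ = inj₂ (begin
    9 * (A + B) ^ 3 * 3 ^ ones a        ≤⟨ *-monoˡ-≤ (3 ^ ones a) (*-monoʳ-≤ 9 (^-monoˡ-≤ 3 (+-monoʳ-≤ A b≤a))) ⟩
    9 * (A + A) ^ 3 * 3 ^ ones a        ≡⟨ lem A (3 ^ ones a) ⟩
    8 * (A ^ 3 * (3 ^ ones a * 3 ^ 2))
      ≤⟨ *-monoʳ-≤ 8 (*-monoʳ-≤ (A ^ 3) (*-monoʳ-≤ (3 ^ ones a) (^-monoʳ-≤ 3 2≤))) ⟩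
    8 * (A ^ 3 * (3 ^ ones a * 3 ^ ones b)) ≡⟨ cong (λ z → 8 * (A ^ 3 * z)) (^-distribˡ-+-* 3 (ones a) (ones b)) ⟨
    8 * (A ^ 3 * 3 ^ (ones a + ones b)) ∎)
  where
  open ≤-Reasoning
  A B : ℕ
  A = eval a
  B = eval b
  lem : ∀ x y → 9 * ((x + x) * ((x + x) * ((x + x) * 1))) * y ≡ 8 * (x * (x * (x * 1)) * (y * 9))
  lem = solve-∀
... | no ¬2≤ with b
... | plus u v = contradiction (+-mono-≤ (ones≥1 u) (ones≥1 v)) ¬2≤
... | times u v = contradiction (+-mono-≤ (ones≥1 u) (ones≥1 v)) ¬2≤
... | one with 3 ≤? eval a
... | no ¬3≤ = inj₁ (refl , refl , ≤-pred (≰⇒> ¬3≤))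
... | yes 3≤ = inj₂ (*-cancelˡ-≤ 27 (begin
    27 * (9 * (A + 1) ^ 3 * 3 ^ ones a)          ≡⟨ lem₁ A (3 ^ ones a) ⟩
    9 * (3 * A + 3) ^ 3 * 3 ^ ones a             ≤⟨ *-monoˡ-≤ (3 ^ ones a) (*-monoʳ-≤ 9 (^-monoˡ-≤ 3 (+-monoʳ-≤ (3 * A) 3≤))) ⟩
    9 * (3 * A + A) ^ 3 * 3 ^ ones a             ≡⟨ lem₂ A (3 ^ ones a) ⟩
    -- 576 = 9 · 4³ and 648 = 27 · 8 · 3, so this is (4/3)³ · 9/8 = 8/3 ≤ 3.
    576 * (A ^ 3 * 3 ^ ones a)                   ≤⟨ *-monoˡ-≤ (A ^ 3 * 3 ^ ones a) (toWitness {a? = 576 ≤? 648} _) ⟩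
    648 * (A ^ 3 * 3 ^ ones a)                   ≡⟨ lem₃ (A ^ 3) (3 ^ ones a) ⟩
    27 * (8 * (A ^ 3 * (3 ^ ones a * 3 ^ 1)))    ≡⟨ cong (λ z → 27 * (8 * (A ^ 3 * z))) (^-distribˡ-+-* 3 (ones a) 1) ⟨
    27 * (8 * (A ^ 3 * 3 ^ (ones a + 1)))        ∎))
  where
  open ≤-Reasoning
  A : ℕ
  A = eval a
  lem₁ : ∀ x y → 27 * (9 * ((x + 1) * ((x + 1) * ((x + 1) * 1))) * y) ≡
                 9 * ((3 * x + 3) * ((3 * x + 3) * ((3 * x + 3) * 1))) * y
  lem₁ = solve-∀
  lem₂ : ∀ x y → 9 * ((3 * x + x) * ((3 * x + x) * ((3 * x + x) * 1))) * y ≡ 576 * (x * (x * (x * 1)) * y)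
  lem₂ = solve-∀
  lem₃ : ∀ x y → 648 * (x * y) ≡ 27 * (8 * (x * (y * 3)))
  lem₃ = solve-∀

-- δ(n) = 0 (with n a positive power of 3) or δ(n) ≥ δ(2), where c bounds ‖n‖ from above.
Gap : ℕ → ℕ → Set
Gap n c = (∃[ j ] (n ≡ 3 ^ suc j × c ≡ 3 * suc j)) ⊎ 9 * n ^ 3 ≤ 8 * 3 ^ c

gap⇒cube-bound : ∀ {n c} → Gap n c → n ^ 3 ≤ 3 ^ c
gap⇒cube-bound (inj₁ (j , refl , refl)) = ≤-reflexive (trans (^-*-assoc 3 (suc j) 3) (cong (3 ^_) (*-comm (suc j) 3)))
gap⇒cube-bound {n} {c} (inj₂ h) = *-cancelˡ-≤ 9 (≤-trans h (*-monoˡ-≤ (3 ^ c) (n≤1+n 8)))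

gap-sum : ∀ a b → Gap (eval a) (ones a) → eval b ≤ eval a → Gap (eval a + eval b) (ones a + ones b)
gap-sum a b ga b≤a with sum-increases a b b≤a
... | inj₂ inc = inj₂ (*-cancelʳ-≤ _ _ (3 ^ ones a) {{m^n≢0 3 (ones a)}} (≤-trans inc (begin
    8 * (eval a ^ 3 * 3 ^ (ones a + ones b))  ≤⟨ *-monoʳ-≤ 8 (*-monoˡ-≤ (3 ^ (ones a + ones b)) (gap⇒cube-bound {c = ones a} ga)) ⟩
    8 * (3 ^ ones a * 3 ^ (ones a + ones b))  ≡⟨ cong (8 *_) (*-comm (3 ^ ones a) _) ⟩
    8 * (3 ^ (ones a + ones b) * 3 ^ ones a)  ≡⟨ *-assoc 8 (3 ^ (ones a + ones b)) (3 ^ ones a) ⟨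
    8 * 3 ^ (ones a + ones b) * 3 ^ ones a    ∎)))
  where open ≤-Reasoning
... | inj₁ (p , q , a≤2) rewrite p | q = small (eval a) (ones a) (eval≥1 a) a≤2 (ones≥1 a) (gap⇒cube-bound {c = ones a} ga)
  where
  small : ∀ n c → 1 ≤ n → n ≤ 2 → 1 ≤ c → n ^ 3 ≤ 3 ^ c → Gap (n + 1) (c + 1)
  small 1 c _ _ 1≤c _ = inj₂ (*-monoʳ-≤ 8 (^-monoʳ-≤ 3 {2} (+-monoˡ-≤ 1 1≤c)))
  -- The sum 2 + 1: a single 1 cannot give 2, as 2³ > 3; two ones give the power 3 at exact cost;
  -- from three ones on, 9 · 3³ = 243 ≤ 648 = 8 · 3⁴.
  small 2 1 _ _ _ h = contradiction h (<⇒≱ (toWitness {a? = 4 ≤? 8} _))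
  small 2 2 _ _ _ _ = inj₁ (0 , refl , refl)
  small 2 (suc (suc (suc c))) _ _ _ _ =
    inj₂ (≤-trans (toWitness {a? = 243 ≤? 648} _) (*-monoʳ-≤ 8 (^-monoʳ-≤ 3 {4} {3 + c + 1} (+-monoʳ-≤ 3 (m≤n+m 1 c)))))
  small (suc (suc (suc _))) _ _ (s≤s (s≤s ())) _ _

-- Defects add up along a product, and the second factor contributes at least δ(2).
product-increases : ∀ {m d n c} → 9 * n ^ 3 ≤ 8 * 3 ^ c → Increases m d (m * n) (d + c)
product-increases {m} {d} {n} {c} h = begin
  9 * (m * n) ^ 3 * 3 ^ d        ≡⟨ cong (λ z → 9 * z * 3 ^ d) (^-distribʳ-* 3 m n) ⟩
  9 * (m ^ 3 * n ^ 3) * 3 ^ d    ≡⟨ lem₁ (m ^ 3) (n ^ 3) (3 ^ d) ⟩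
  m ^ 3 * 3 ^ d * (9 * n ^ 3)    ≤⟨ *-monoʳ-≤ (m ^ 3 * 3 ^ d) h ⟩
  m ^ 3 * 3 ^ d * (8 * 3 ^ c)    ≡⟨ lem₂ (m ^ 3) (3 ^ c) (3 ^ d) ⟩
  8 * (m ^ 3 * (3 ^ d * 3 ^ c))  ≡⟨ cong (λ z → 8 * (m ^ 3 * z)) (^-distribˡ-+-* 3 d c) ⟨
  8 * (m ^ 3 * 3 ^ (d + c))      ∎
  where
  open ≤-Reasoning
  lem₁ : ∀ x y z → 9 * (x * y) * z ≡ x * z * (9 * y)
  lem₁ = solve-∀
  lem₂ : ∀ x y z → x * z * (8 * y) ≡ 8 * (x * (z * y))
  lem₂ = solve-∀

gap-product : ∀ {m d n c} → Gap m d → 9 * n ^ 3 ≤ 8 * 3 ^ c → 9 * (m * n) ^ 3 ≤ 8 * 3 ^ (d + c)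
gap-product {m} {d} {n} {c} gm h = begin
  9 * (m * n) ^ 3            ≡⟨ cong (9 *_) (^-distribʳ-* 3 m n) ⟩
  9 * (m ^ 3 * n ^ 3)        ≡⟨ lem (m ^ 3) (n ^ 3) 9 ⟩
  m ^ 3 * (9 * n ^ 3)        ≤⟨ *-mono-≤ (gap⇒cube-bound {c = d} gm) h ⟩
  3 ^ d * (8 * 3 ^ c)        ≡⟨ lem (3 ^ d) (3 ^ c) 8 ⟨
  8 * (3 ^ d * 3 ^ c)        ≡⟨ cong (8 *_) (^-distribˡ-+-* 3 d c) ⟨
  8 * 3 ^ (d + c)            ∎
  where
  open ≤-Reasoning
  lem : ∀ x y z → z * (x * y) ≡ x * (z * y)
  lem = solve-∀

-- Valid for every expression, efficient or not. A product gets δ(2) from either factor that has it;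
-- if neither does, both are powers of 3 at exact cost, and so is the product.
gap : ∀ e → Gap (eval e) (ones e)
gap one = inj₂ (toWitness {a? = 9 ≤? 24} _)
gap (plus a b) with ≤-total (eval b) (eval a)
... | inj₁ b≤a = gap-sum a b (gap a) b≤a
... | inj₂ a≤b = subst₂ Gap (+-comm (eval b) (eval a)) (+-comm (ones b) (ones a)) (gap-sum b a (gap b) a≤b)
gap (times a b) with gap a | gap b
... | ga | inj₂ h = inj₂ (gap-product {d = ones a} ga h)
... | inj₂ h | gb@(inj₁ _) =
  inj₂ (subst₂ (λ n c → 9 * n ^ 3 ≤ 8 * 3 ^ c) (*-comm (eval b) (eval a)) (+-comm (ones b) (ones a))
    (gap-product {d = ones b} gb h))
... | inj₁ (i , p , q) | inj₁ (j , r , s) = inj₁ (i + suc j ,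
  trans (cong₂ _*_ p r) (sym (^-distribˡ-+-* 3 (suc i) (suc j))) ,
  trans (cong₂ _+_ q s) (sym (*-distribˡ-+ 3 (suc i) (suc j))))

cube-bound : ∀ e → eval e ^ 3 ≤ 3 ^ ones e
cube-bound e = gap⇒cube-bound {c = ones e} (gap e)

-- δ(n) < k δ(2)
Below : ℕ → ℕ → ℕ → Set
Below k n c = 8 ^ k * 3 ^ c < 9 ^ k * n ^ 3

-- Both sides lose one δ(2); the induction on `k` rests on this.
increase-descends : ∀ k {m d n c} → Increases m d n c → Below (suc k) n c → Below k m d
increase-descends k {m} {d} {n} {c} inc below = ≰⇒> λ h → <⇒≱
  (*-monoˡ-< (3 ^ d) {{m^n≢0 3 d}} below) (begin
  9 ^ suc k * n ^ 3 * 3 ^ d          ≡⟨ lem₁ (9 ^ k) (n ^ 3) (3 ^ d) ⟩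
  9 ^ k * (9 * n ^ 3 * 3 ^ d)        ≤⟨ *-monoʳ-≤ (9 ^ k) inc ⟩
  9 ^ k * (8 * (m ^ 3 * 3 ^ c))      ≡⟨ lem₂ (9 ^ k) (m ^ 3) (3 ^ c) ⟩
  9 ^ k * m ^ 3 * (8 * 3 ^ c)        ≤⟨ *-monoˡ-≤ (8 * 3 ^ c) h ⟩
  8 ^ k * 3 ^ d * (8 * 3 ^ c)        ≡⟨ lem₃ (8 ^ k) (3 ^ d) (3 ^ c) ⟩
  8 ^ suc k * 3 ^ c * 3 ^ d          ∎)
  where
  open ≤-Reasoning
  lem₁ : ∀ x y z → 9 * x * y * z ≡ x * (9 * y * z)
  lem₁ = solve-∀
  lem₂ : ∀ x y z → x * (8 * (y * z)) ≡ x * y * (8 * z)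
  lem₂ = solve-∀
  lem₃ : ∀ x y z → x * y * (8 * z) ≡ 8 * x * z * y
  lem₃ = solve-∀

-- A factor 3 bought with three ones does not change the defect.
strip-below : ∀ k j {m d} → Below k (3 ^ j * m) (3 * j + d) → Below k m d
strip-below k j {m} {d} below = *-cancelˡ-< ((3 ^ j) ^ 3) _ _ (subst₂ _<_ left right below)
  where
  lem : ∀ x y z → x * (y * z) ≡ y * (x * z)
  lem = solve-∀
  left : 8 ^ k * 3 ^ (3 * j + d) ≡ (3 ^ j) ^ 3 * (8 ^ k * 3 ^ d)
  left = trans (cong (8 ^ k *_) (trans (^-distribˡ-+-* 3 (3 * j) d)
    (cong (_* 3 ^ d) (trans (cong (3 ^_) (*-comm 3 j)) (sym (^-*-assoc 3 j 3)))))) (lem (8 ^ k) ((3 ^ j) ^ 3) (3 ^ d))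
  right : 9 ^ k * (3 ^ j * m) ^ 3 ≡ (3 ^ j) ^ 3 * (9 ^ k * m ^ 3)
  right = trans (cong (9 ^ k *_) (^-distribʳ-* 3 (3 ^ j) m)) (lem (9 ^ k) ((3 ^ j) ^ 3) (m ^ 3))

-- Finitely many low-defect pairs, without regard to degree.

infixl 7 _⊗_
infixl 6 _·x+_

-- Low-defect pairs whose constants are kept as expressions, with C the total number of their 1's.
data Tree : Set where
  con : Expr → Tree
  _⊗_ : Tree → Tree → Tree
  _·x+_ : Tree → Expr → Tree

-- Rep f n c: some substitution of powers of 3 into (f , C) gives n, with C + 3 ∑ nᵢ = c.
data Rep : Tree → ℕ → ℕ → Set where
  con : ∀ e → Rep (con e) (eval e) (ones e)
  ten : ∀ {f g m d n c} → Rep f m d → Rep g n c → Rep (f ⊗ g) (m * n) (d + c)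
  add : ∀ {f b n c} j → Rep f n c → Rep (f ·x+ b) (3 ^ j * n + eval b) (3 * j + c + ones b)

RepresentedIn : List Tree → ℕ → ℕ → Set
RepresentedIn S n c = ∃[ f ] (f ∈ S × Rep f n c)

-- The blocks match the ways in which `build-represents` decomposes a number: up to 3, product, sum.
-- In a sum only the smaller summand is kept as a constant, and `summand-bounded` supplies the bound
-- on its ones.
build : ℕ → List Tree
build zero = []
build (suc k) = map con (exprs 3) ++
  (cartesianProductWith _⊗_ (build k) (build k) ++
   cartesianProductWith _·x+_ (build k) (exprs (8 * 9 ^ suc k)))

minimal-plusˡ : ∀ {a b} → IsComplexity (eval a + eval b) (ones a + ones b) → IsComplexity (eval a) (ones a)
minimal-plusˡ {a} {b} (_ , min) = (a , refl , refl) , λ e q →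
  +-cancelʳ-≤ (ones b) _ _ (min (plus e b) (cong (_+ eval b) q))

minimal-timesˡ : ∀ {a b} → IsComplexity (eval a * eval b) (ones a + ones b) → IsComplexity (eval a) (ones a)
minimal-timesˡ {a} {b} (_ , min) = (a , refl , refl) , λ e q →
  +-cancelʳ-≤ (ones b) _ _ (min (times e b) (cong (_* eval b) q))

tripling-free-timesˡ : ∀ {a b} → Tripling-free (eval a * eval b) (ones a + ones b) → Tripling-free (eval a) (ones a)
tripling-free-timesˡ {a} {b} tf e p q = tf (times e b)
  (trans (cong (_* eval b) p) (*-assoc 3 (eval e) (eval b)))
  (trans (cong (_+ ones b) q) (+-assoc 3 (ones e) (ones b)))

-- Were `a` a power 3^(j+1) at exact cost, then a b = 3 (3^j b) would split off a factor 3 at the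
-- price of three ones.
tripling-free⇒gapˡ : ∀ a b → Tripling-free (eval a * eval b) (ones a + ones b) → 9 * eval a ^ 3 ≤ 8 * 3 ^ ones a
tripling-free⇒gapˡ a b tf with gap a
... | inj₂ h = h
... | inj₁ (j , p , q) = contradiction
  (trans (cong (_+ ones b) (trans q (*-suc 3 j)))
    (trans (+-assoc 3 (3 * j) (ones b)) (cong (3 +_) (sym (ones-times-threes j b)))))
  (tf (times-threes j b)
    (trans (cong (_* eval b) p) (trans (*-assoc 3 (3 ^ j) (eval b)) (cong (3 *_) (sym (eval-times-threes j b))))))

represent-small : ∀ k {n c} → IsComplexity n c → 1 ≤ n → n ≤ 3 → RepresentedIn (build (suc k)) n c
represent-small k {n} {c} ck@((e , refl , refl) , min) 1≤n n≤3 =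
  con e , ∈-++⁺ˡ (∈-map⁺ con (∈-exprs e (c≤3 n 1≤n n≤3 min))) , con e
  where
  c≤3 : ∀ n → 1 ≤ n → n ≤ 3 → (∀ e' → eval e' ≡ n → c ≤ ones e') → c ≤ 3
  c≤3 1 _ _ min = ≤-trans (min one refl) (s≤s z≤n)
  c≤3 2 _ _ min = ≤-trans (min (plus one one) refl) (s≤s (s≤s z≤n))
  c≤3 3 _ _ min = min three refl
  c≤3 (suc (suc (suc (suc _)))) _ (s≤s (s≤s (s≤s ()))) _

n≤3^n : ∀ n → n ≤ 3 ^ n
n≤3^n zero = z≤n
n≤3^n (suc n) = begin
  1 + n              ≤⟨ +-mono-≤ (m^n>0 3 n) (n≤3^n n) ⟩
  3 ^ n + 3 ^ n      ≤⟨ +-monoʳ-≤ (3 ^ n) (m≤m+n (3 ^ n) _) ⟩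
  3 ^ suc n          ∎
  where open ≤-Reasoning

-- Since b ≤ a and δ(a) ≥ 0, the defect of the sum is at least `ones b` - 3 log₃ 2, whence 3^(ones
-- b) < 8 (9/8)^k. The cruder bound suffices for finiteness.
summand-bounded : ∀ k a b → eval b ≤ eval a → Below k (eval a + eval b) (ones a + ones b) → ones b ≤ 8 * 9 ^ k
summand-bounded k a b b≤a below = ≤-trans (n≤3^n (ones b)) (<⇒≤ (*-cancelʳ-< (3 ^ ones a) (3 ^ ones b) (8 * 9 ^ k) (begin-strict
  3 ^ ones b * 3 ^ ones a           ≡⟨ *-comm (3 ^ ones b) (3 ^ ones a) ⟩
  3 ^ ones a * 3 ^ ones b           ≡⟨ ^-distribˡ-+-* 3 (ones a) (ones b) ⟨
  3 ^ (ones a + ones b)             ≤⟨ m≤n*m _ (8 ^ k) {{m^n≢0 8 k}} ⟩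
  8 ^ k * 3 ^ (ones a + ones b)     <⟨ below ⟩
  9 ^ k * (eval a + eval b) ^ 3     ≤⟨ *-monoʳ-≤ (9 ^ k) (^-monoˡ-≤ 3 (+-monoʳ-≤ (eval a) b≤a)) ⟩
  9 ^ k * (eval a + eval a) ^ 3     ≡⟨ lem (9 ^ k) (eval a) ⟩
  8 * 9 ^ k * eval a ^ 3            ≤⟨ *-monoʳ-≤ (8 * 9 ^ k) (cube-bound a) ⟩
  8 * 9 ^ k * 3 ^ ones a            ∎)))
  where
  open ≤-Reasoning
  lem : ∀ x y → x * ((y + y) * ((y + y) * ((y + y) * 1))) ≡ 8 * x * (y * (y * (y * 1)))
  lem = solve-∀

build-represents : ∀ k {n c} → IsComplexity n c → Tripling-free n c → Below k n c → RepresentedIn (build k) n c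
build-represents-sum : ∀ k a b → eval b ≤ eval a → IsComplexity (eval a + eval b) (ones a + ones b) →
  Below (suc k) (eval a + eval b) (ones a + ones b) → RepresentedIn (build (suc k)) (eval a + eval b) (ones a + ones b)

-- The bound here is δ(n) < 0, which `cube-bound` excludes.
build-represents zero {c = c} ((e , refl , refl) , _) tf below =
  contradiction (subst₂ _<_ (*-identityˡ (3 ^ c)) (*-identityˡ (eval e ^ 3)) below) (≤⇒≯ (cube-bound e))
build-represents (suc k) ck@((one , refl , refl) , _) tf below = represent-small k ck ≤-refl (s≤s z≤n)
build-represents (suc k) ck@((plus a b , refl , refl) , _) tf below with ≤-total (eval b) (eval a)
... | inj₁ b≤a = build-represents-sum k a b b≤a ck below
... | inj₂ a≤b with +-comm (eval b) (eval a) | +-comm (ones b) (ones a)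
... | p | q = subst₂ (RepresentedIn (build (suc k))) p q
  (build-represents-sum k b a a≤b (subst₂ IsComplexity (sym p) (sym q) ck)
    (subst₂ (Below (suc k)) (sym p) (sym q) below))
-- Each factor inherits minimality and tripling-freeness. Its cofactor has defect at least δ(2), so
-- its own drops below k δ(2).
build-represents (suc k) ck@((times a b , refl , refl) , _) tf below =
  let p = *-comm (eval a) (eval b)
      q = +-comm (ones a) (ones b)
      tf' = subst₂ Tripling-free p q tf
      f , f∈ , rf = build-represents k (minimal-timesˡ {a} {b} ck) (tripling-free-timesˡ {a} {b} tf)
        (increase-descends k {eval a} {ones a} {eval a * eval b} {ones a + ones b}
          (product-increases {eval a} {ones a} {eval b} {ones b} (tripling-free⇒gapˡ b a tf')) below)
      g , g∈ , rg = build-represents k (minimal-timesˡ {b} {a} (subst₂ IsComplexity p q ck)) (tripling-free-timesˡ {b} {a} tf')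
        (increase-descends k {eval b} {ones b} {eval b * eval a} {ones b + ones a}
          (product-increases {eval b} {ones b} {eval a} {ones a} (tripling-free⇒gapˡ a b tf))
          (subst₂ (Below (suc k)) p q below))
  in f ⊗ g , ∈-++⁺ʳ (map con (exprs 3)) (∈-++⁺ˡ (∈-cartesianProductWith⁺ _⊗_ f∈ g∈)) , ten rf rg

build-represents-sum k a b b≤a ck below with sum-increases a b b≤a
... | inj₁ (_ , p , a≤2) = represent-small k ck (≤-trans (eval≥1 a) (m≤m+n _ _)) (+-mono-≤ a≤2 (≤-reflexive p))
... | inj₂ inc =
  -- A summand need not be tripling-free itself; its factor 3^j becomes the value of the new
  -- variable.
  let j , m , d , p , q , mk , tf = strip-threes (minimal-plusˡ {a} {b} ck)
      below-a = increase-descends k {eval a} {ones a} {eval a + eval b} {ones a + ones b} inc below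
      f , f∈ , rf = build-represents k mk tf (strip-below k j {m} {d} (subst₂ (Below k) p q below-a))
  in f ·x+ b ,
     ∈-++⁺ʳ (map con (exprs 3)) (∈-++⁺ʳ (cartesianProductWith _⊗_ (build k) (build k))
       (∈-cartesianProductWith⁺ _·x+_ f∈ (∈-exprs b (summand-bounded (suc k) a b b≤a below)))) ,
     subst₂ (Rep (f ·x+ b)) (cong (_+ eval b) (sym p)) (cong (_+ ones b) (sym q)) (add j rf)

-- Limiting defect and truncation of innermost variables.

degree base : Tree → ℕ
degree (con e) = 0
degree (f ⊗ g) = degree f + degree g
degree (f ·x+ b) = suc (degree f)
base (con e) = ones e
base (f ⊗ g) = base f + base g
base (f ·x+ b) = base f + ones b

-- Its value is f(1,...,1), which in degree 0 is the only value.
lowest : Tree → Expr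
lowest (con e) = e
lowest (f ⊗ g) = times (lowest f) (lowest g)
lowest (f ·x+ b) = plus (lowest f) b

rep-degree0 : ∀ {f n c} → Rep f n c → degree f ≡ 0 → n ≡ eval (lowest f) × c ≡ ones (lowest f)
rep-degree0 (con e) _ = refl , refl
rep-degree0 (ten {f} {g} rf rg) d≡0 =
  let p , q = rep-degree0 rf (m+n≡0⇒m≡0 (degree f) d≡0)
      r , s = rep-degree0 rg (m+n≡0⇒n≡0 (degree f) d≡0)
  in cong₂ _*_ p r , cong₂ _+_ q s

rep≥1 : ∀ {f n c} → Rep f n c → 1 ≤ n
rep≥1 (con e) = eval≥1 e
rep≥1 (ten rf rg) = *-mono-≤ (rep≥1 rf) (rep≥1 rg)
rep≥1 (add {b = b} j rf) = ≤-trans (eval≥1 b) (m≤n+m _ _)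

-- Says n + s ≤ (1 + 1/t) 3^{(c - d)/3}, so the defect c - 3 log₃ n is at least d, up to an error vanishing as t → ∞.
-- The slack s absorbs the constants added further out.
AlmostDefect≥ : (t s d n c : ℕ) → Set
AlmostDefect≥ t s d n c = ((n + s) * t) ^ 3 * 3 ^ d ≤ (t + 1) ^ 3 * 3 ^ c

-- Two errors 1 + 1/u multiply to at most 1 + 1/t, because (t + 1)u² exceeds t(u + 1)² by t + 1.
cube-ratio : ∀ t → let u = 2 * t + 1 in t ^ 3 * ((u + 1) ^ 3 * (u + 1) ^ 3) ≤ (t + 1) ^ 3 * (u ^ 3 * u ^ 3)
cube-ratio t = subst₂ _≤_ (distrib t (u + 1)) (distrib (t + 1) u)
  (^-monoˡ-≤ 3 (≤-trans (m≤m+n (t * ((u + 1) * (u + 1))) (t + 1)) (≤-reflexive (lem t))))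
  where
  u : ℕ
  u = 2 * t + 1
  distrib : ∀ x y → (x * (y * y)) ^ 3 ≡ x ^ 3 * (y ^ 3 * y ^ 3)
  distrib x y = trans (^-distribʳ-* 3 x (y * y)) (cong (x ^ 3 *_) (^-distribʳ-* 3 y y))
  lem : ∀ t → t * ((2 * t + 1 + 1) * (2 * t + 1 + 1)) + (t + 1) ≡ (t + 1) * ((2 * t + 1) * (2 * t + 1))
  lem = solve-∀

-- Defects add in a product, and `cube-ratio` absorbs the two errors. The first hypothesis leaves
-- open how the slack is split.
almost-⊗ : ∀ t {s₁ s₂ s d₁ d₂ m n c₁ c₂} → m * n + s ≤ (m + s₁) * (n + s₂) →
  AlmostDefect≥ (2 * t + 1) s₁ d₁ m c₁ → AlmostDefect≥ (2 * t + 1) s₂ d₂ n c₂ →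
  AlmostDefect≥ t s (d₁ + d₂) (m * n) (c₁ + c₂)
almost-⊗ t {s₁} {s₂} {s} {d₁} {d₂} {m} {n} {c₁} {c₂} h h₁ h₂ =
  *-cancelʳ-≤ _ _ (u ^ 3 * u ^ 3) {{m*n≢0 (u ^ 3) (u ^ 3) {{u³≢0}} {{u³≢0}}}} (begin
  ((m * n + s) * t) ^ 3 * 3 ^ (d₁ + d₂) * (u ^ 3 * u ^ 3)
    ≤⟨ *-monoˡ-≤ (u ^ 3 * u ^ 3) (*-monoˡ-≤ (3 ^ (d₁ + d₂)) (^-monoˡ-≤ 3 (*-monoˡ-≤ t h))) ⟩
  (M * N * t) ^ 3 * 3 ^ (d₁ + d₂) * (u ^ 3 * u ^ 3)
    ≡⟨ cong₂ (λ x y → x * y * (u ^ 3 * u ^ 3))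
         (trans (^-distribʳ-* 3 (M * N) t) (cong (_* t ^ 3) (^-distribʳ-* 3 M N))) (^-distribˡ-+-* 3 d₁ d₂) ⟩
  M ^ 3 * N ^ 3 * t ^ 3 * (3 ^ d₁ * 3 ^ d₂) * (u ^ 3 * u ^ 3)
    ≡⟨ lem₁ (M ^ 3) (N ^ 3) (t ^ 3) (3 ^ d₁) (3 ^ d₂) (u ^ 3) ⟩
  t ^ 3 * (M ^ 3 * u ^ 3 * 3 ^ d₁ * (N ^ 3 * u ^ 3 * 3 ^ d₂))
    ≡⟨ cong₂ (λ x y → t ^ 3 * (x * 3 ^ d₁ * (y * 3 ^ d₂))) (^-distribʳ-* 3 M u) (^-distribʳ-* 3 N u) ⟨
  t ^ 3 * ((M * u) ^ 3 * 3 ^ d₁ * ((N * u) ^ 3 * 3 ^ d₂))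
    ≤⟨ *-monoʳ-≤ (t ^ 3) (*-mono-≤ h₁ h₂) ⟩
  t ^ 3 * ((u + 1) ^ 3 * 3 ^ c₁ * ((u + 1) ^ 3 * 3 ^ c₂))
    ≡⟨ lem₂ (t ^ 3) ((u + 1) ^ 3) (3 ^ c₁) (3 ^ c₂) ⟩
  t ^ 3 * ((u + 1) ^ 3 * (u + 1) ^ 3) * (3 ^ c₁ * 3 ^ c₂)
    ≤⟨ *-monoˡ-≤ (3 ^ c₁ * 3 ^ c₂) (cube-ratio t) ⟩
  (t + 1) ^ 3 * (u ^ 3 * u ^ 3) * (3 ^ c₁ * 3 ^ c₂)
    ≡⟨ lem₃ ((t + 1) ^ 3) (u ^ 3 * u ^ 3) (3 ^ c₁ * 3 ^ c₂) ⟩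
  (t + 1) ^ 3 * (3 ^ c₁ * 3 ^ c₂) * (u ^ 3 * u ^ 3)
    ≡⟨ cong (λ x → (t + 1) ^ 3 * x * (u ^ 3 * u ^ 3)) (^-distribˡ-+-* 3 c₁ c₂) ⟨
  (t + 1) ^ 3 * 3 ^ (c₁ + c₂) * (u ^ 3 * u ^ 3) ∎)
  where
  open ≤-Reasoning
  u M N : ℕ
  u = 2 * t + 1
  M = m + s₁
  N = n + s₂
  u³≢0 : NonZero (u ^ 3)
  u³≢0 = m^n≢0 u 3 {{>-nonZero (m≤n+m 1 (2 * t))}}
  lem₁ : ∀ a b c d e v → a * b * c * (d * e) * (v * v) ≡ c * (a * v * d * (b * v * e))
  lem₁ = solve-∀
  lem₂ : ∀ a b c d → a * (b * c * (b * d)) ≡ a * (b * b) * (c * d)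
  lem₂ = solve-∀
  lem₃ : ∀ a b c → a * b * c ≡ a * c * b
  lem₃ = solve-∀

-- The factor 3^j at cost 3j keeps the defect, and the added constant costs at least one more 1. `x`
-- and `y` already carry the factors t or t + 1, which lets both cases of `truncate` use this.
almost-add : ∀ j {x y d a c o} → x ≤ 3 ^ j * y → 1 ≤ o → y ^ 3 * 3 ^ d ≤ a * 3 ^ c →
  x ^ 3 * 3 ^ suc d ≤ a * 3 ^ (3 * j + c + o)
almost-add j {x} {y} {d} {a} {c} {o} h 1≤o g = begin
  x ^ 3 * 3 ^ suc d                            ≤⟨ *-monoˡ-≤ (3 ^ suc d) (^-monoˡ-≤ 3 h) ⟩
  (3 ^ j * y) ^ 3 * 3 ^ suc d                  ≡⟨ cong (_* 3 ^ suc d) (^-distribʳ-* 3 (3 ^ j) y) ⟩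
  (3 ^ j) ^ 3 * y ^ 3 * (3 * 3 ^ d)            ≡⟨ lem₁ ((3 ^ j) ^ 3) (y ^ 3) (3 ^ d) ⟩
  y ^ 3 * 3 ^ d * ((3 ^ j) ^ 3 * 3 ^ 1)        ≤⟨ *-mono-≤ g (*-monoʳ-≤ ((3 ^ j) ^ 3) (^-monoʳ-≤ 3 1≤o)) ⟩
  a * 3 ^ c * ((3 ^ j) ^ 3 * 3 ^ o)            ≡⟨ lem₂ a (3 ^ c) ((3 ^ j) ^ 3) (3 ^ o) ⟩
  a * ((3 ^ j) ^ 3 * 3 ^ c * 3 ^ o)
    ≡⟨ cong (λ z → a * (z * 3 ^ c * 3 ^ o)) (trans (^-*-assoc 3 j 3) (cong (3 ^_) (*-comm j 3))) ⟩
  a * (3 ^ (3 * j) * 3 ^ c * 3 ^ o)            ≡⟨ cong (λ z → a * (z * 3 ^ o)) (^-distribˡ-+-* 3 (3 * j) c) ⟨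
  a * (3 ^ (3 * j + c) * 3 ^ o)                ≡⟨ cong (a *_) (^-distribˡ-+-* 3 (3 * j + c) o) ⟨
  a * 3 ^ (3 * j + c + o)                      ∎
  where
  open ≤-Reasoning
  lem₁ : ∀ a b c → a * b * (3 * c) ≡ b * c * (a * 3)
  lem₁ = solve-∀
  lem₂ : ∀ a b c d → a * b * (c * d) ≡ a * (c * b * d)
  lem₂ = solve-∀

Truncation : (f : Tree) (t s : ℕ) → Set
Truncation f t s = Σ (List Tree) λ L → All (λ g → suc (degree g) ≡ degree f) L ×
  (∀ {n c} → Rep f n c → RepresentedIn L n c ⊎ AlmostDefect≥ t s (degree f) n c)

-- Truncating one factor truncates the product; the two estimates are combined only when neither
-- factor falls into its list.
truncate-⊗ : ∀ {f g} t {s₁ s₂} s → (∀ {m n} → 1 ≤ m → 1 ≤ n → m * n + s ≤ (m + s₁) * (n + s₂)) →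
  Truncation f (2 * t + 1) s₁ → Truncation g (2 * t + 1) s₂ → Truncation (f ⊗ g) t s
truncate-⊗ {f} {g} t {s₁} {s₂} s h (L , degL , repL) (M , degM , repM) =
  map (_⊗ g) L ++ map (f ⊗_) M ,
  All.++⁺ (All.map⁺ (mapAll (cong (_+ degree g)) degL))
          (All.map⁺ (mapAll (λ {k} p → trans (sym (+-suc (degree f) (degree k))) (cong (degree f +_) p)) degM)) ,
  represent
  where
  represent : ∀ {n c} → Rep (f ⊗ g) n c →
    RepresentedIn (map (_⊗ g) L ++ map (f ⊗_) M) n c ⊎ AlmostDefect≥ t s (degree f + degree g) n c
  represent (ten {m = m} {c₁} {n} {c₂} rf rg) with repL rf | repM rg
  ... | inj₁ (k , k∈ , rk) | _ = inj₁ (k ⊗ g , ∈-++⁺ˡ (∈-map⁺ (_⊗ g) k∈) , ten rk rg)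
  ... | inj₂ _ | inj₁ (k , k∈ , rk) = inj₁ (f ⊗ k , ∈-++⁺ʳ (map (_⊗ g) L) (∈-map⁺ (f ⊗_) k∈) , ten rf rk)
  ... | inj₂ p | inj₂ q = inj₂ (almost-⊗ t {s₁} {s₂} {s} {degree f} {degree g} {m} {n} {c₁} {c₂}
      (h (rep≥1 rf) (rep≥1 rg)) p q)

-- If f has variables then all innermost ones being large makes b negligible; otherwise the new variable is itself
-- innermost and must be large.
truncate : ∀ f t s → s ≡ 0 ⊎ 1 ≤ degree f → Truncation f t s
-- A constant cannot absorb slack, hence the side condition; with slack 0, nonnegativity of the
-- defect is enough.
truncate (con e) t .0 (inj₁ refl) = [] , [] , λ where (con e) → inj₂ (bound e)
  where
  bound : ∀ e → AlmostDefect≥ t 0 0 (eval e) (ones e)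
  bound e = begin
    ((eval e + 0) * t) ^ 3 * 1      ≡⟨ trans (*-identityʳ _) (cong (λ z → (z * t) ^ 3) (+-identityʳ (eval e))) ⟩
    (eval e * t) ^ 3                ≡⟨ ^-distribʳ-* 3 (eval e) t ⟩
    eval e ^ 3 * t ^ 3              ≤⟨ *-mono-≤ (cube-bound e) (^-monoˡ-≤ 3 (m≤m+n t 1)) ⟩
    3 ^ ones e * (t + 1) ^ 3        ≡⟨ *-comm (3 ^ ones e) _ ⟩
    (t + 1) ^ 3 * 3 ^ ones e        ∎
    where open ≤-Reasoning
truncate (f ⊗ g) t s h with 1 ≤? degree g
-- The whole slack goes to one factor, to `g` if it has a variable and otherwise to `f`; the other
-- gets slack 0, for which the side condition always holds.
... | yes 1≤g = truncate-⊗ t s product≤ (truncate f (2 * t + 1) 0 (inj₁ refl)) (truncate g (2 * t + 1) s (inj₂ 1≤g))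
  where
  product≤ : ∀ {m n} → 1 ≤ m → 1 ≤ n → m * n + s ≤ (m + 0) * (n + s)
  product≤ {m} {n} 1≤m _ = begin
    m * n + s              ≤⟨ +-monoʳ-≤ (m * n) (m≤n*m s m {{>-nonZero 1≤m}}) ⟩
    m * n + m * s          ≡⟨ *-distribˡ-+ m n s ⟨
    m * (n + s)            ≡⟨ cong (_* (n + s)) (+-identityʳ m) ⟨
    (m + 0) * (n + s)      ∎
    where open ≤-Reasoning
... | no g≱1 = truncate-⊗ t s product≤ (truncate f (2 * t + 1) s (side h)) (truncate g (2 * t + 1) 0 (inj₁ refl))
  where
  side : s ≡ 0 ⊎ 1 ≤ degree f + degree g → s ≡ 0 ⊎ 1 ≤ degree f
  side (inj₁ s≡0) = inj₁ s≡0
  side (inj₂ 1≤d) = inj₂ (subst (1 ≤_) (trans (cong (degree f +_) (n<1⇒n≡0 (≰⇒> g≱1))) (+-identityʳ (degree f))) 1≤d)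
  product≤ : ∀ {m n} → 1 ≤ m → 1 ≤ n → m * n + s ≤ (m + s) * (n + 0)
  product≤ {m} {n} _ 1≤n = begin
    m * n + s              ≤⟨ +-monoʳ-≤ (m * n) (m≤m*n s n {{>-nonZero 1≤n}}) ⟩
    m * n + s * n          ≡⟨ *-distribʳ-+ n m s ⟨
    (m + s) * n            ≡⟨ cong ((m + s) *_) (+-identityʳ n) ⟨
    (m + s) * (n + 0)      ∎
    where open ≤-Reasoning
truncate (f ·x+ b) t s _ with 1 ≤? degree f
-- The constant `b` joins the slack that `f` has to absorb.
... | yes 1≤f = let L , degL , repL = truncate f t (eval b + s) (inj₂ 1≤f) in
  map (_·x+ b) L , All.map⁺ (mapAll (cong suc) degL) , represent L repL
  where
  scaled≤ : ∀ j m → (3 ^ j * m + eval b + s) * t ≤ 3 ^ j * ((m + (eval b + s)) * t)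
  scaled≤ j m = begin
    (3 ^ j * m + eval b + s) * t               ≡⟨ cong (_* t) (+-assoc (3 ^ j * m) (eval b) s) ⟩
    (3 ^ j * m + (eval b + s)) * t             ≤⟨ *-monoˡ-≤ t (+-monoʳ-≤ (3 ^ j * m) (m≤n*m (eval b + s) (3 ^ j) {{m^n≢0 3 j}})) ⟩
    (3 ^ j * m + 3 ^ j * (eval b + s)) * t     ≡⟨ cong (_* t) (*-distribˡ-+ (3 ^ j) m (eval b + s)) ⟨
    3 ^ j * (m + (eval b + s)) * t             ≡⟨ *-assoc (3 ^ j) (m + (eval b + s)) t ⟩
    3 ^ j * ((m + (eval b + s)) * t)           ∎
    where open ≤-Reasoning
  represent : ∀ L → (∀ {n c} → Rep f n c → RepresentedIn L n c ⊎ AlmostDefect≥ t (eval b + s) (degree f) n c) →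
    ∀ {n c} → Rep (f ·x+ b) n c →
      RepresentedIn (map (_·x+ b) L) n c ⊎ AlmostDefect≥ t s (suc (degree f)) n c
  represent L repL (add {n = m} {c = c} j rf) with repL rf
  ... | inj₁ (k , k∈ , rk) = inj₁ (k ·x+ b , ∈-map⁺ (_·x+ b) k∈ , add j rk)
  ... | inj₂ p = inj₂ (almost-add j {d = degree f} {a = (t + 1) ^ 3} {c = c} (scaled≤ j m) (ones≥1 b) p)
... | no f≱1 = map constant (upTo K) , All.map⁺ (All.universal (λ _ → cong suc (sym degree≡0)) (upTo K)) , represent
  where
  degree≡0 : degree f ≡ 0
  degree≡0 = n<1⇒n≡0 (≰⇒> f≱1)
  -- From j = K on, 3^j ≥ K makes constant and slack, scaled by t, at most 3^j `eval e`, which turns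
  -- t into t + 1. For the finitely many j < K the value is a constant.
  K : ℕ
  K = (eval b + s) * t
  e : Expr
  e = lowest f
  constant : ℕ → Tree
  constant j = con (plus (times-threes j e) b)
  scaled≤ : ∀ j → K ≤ j → (3 ^ j * eval e + eval b + s) * t ≤ 3 ^ j * (eval e * (t + 1))
  scaled≤ j K≤j = begin
    (3 ^ j * eval e + eval b + s) * t          ≡⟨ lem (3 ^ j) (eval e) (eval b) s t ⟩
    3 ^ j * (eval e * t) + K                   ≤⟨ +-monoʳ-≤ (3 ^ j * (eval e * t))
                                                  (≤-trans K≤j (≤-trans (n≤3^n j) (m≤m*n (3 ^ j) (eval e) {{>-nonZero (eval≥1 e)}}))) ⟩
    3 ^ j * (eval e * t) + 3 ^ j * eval e      ≡⟨ lem' (3 ^ j) (eval e) t ⟩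
    3 ^ j * (eval e * (t + 1))                 ∎
    where
    open ≤-Reasoning
    lem : ∀ x y z s t → (x * y + z + s) * t ≡ x * (y * t) + (z + s) * t
    lem = solve-∀
    lem' : ∀ x y t → x * (y * t) + x * y ≡ x * (y * (t + 1))
    lem' = solve-∀
  lowest-bound : (eval e * (t + 1)) ^ 3 * 3 ^ 0 ≤ (t + 1) ^ 3 * 3 ^ ones e
  lowest-bound = begin
    (eval e * (t + 1)) ^ 3 * 1      ≡⟨ trans (*-identityʳ _) (^-distribʳ-* 3 (eval e) (t + 1)) ⟩
    eval e ^ 3 * (t + 1) ^ 3        ≤⟨ *-monoˡ-≤ ((t + 1) ^ 3) (cube-bound e) ⟩
    3 ^ ones e * (t + 1) ^ 3        ≡⟨ *-comm (3 ^ ones e) _ ⟩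
    (t + 1) ^ 3 * 3 ^ ones e        ∎
    where open ≤-Reasoning
  represent : ∀ {n c} → Rep (f ·x+ b) n c →
    RepresentedIn (map constant (upTo K)) n c ⊎ AlmostDefect≥ t s (suc (degree f)) n c
  represent (add j rf) with rep-degree0 rf degree≡0 | j <? K
  ... | refl , refl | yes j<K = inj₁ (constant j , ∈-map⁺ constant (∈-upTo⁺ j<K) ,
    subst₂ (Rep (constant j)) (cong (_+ eval b) (eval-times-threes j e)) (cong (_+ ones b) (ones-times-threes j e)) (con _))
  ... | refl , refl | no j≮K = inj₂ (subst
    (λ d → AlmostDefect≥ t s (suc d) (3 ^ j * eval e + eval b) (3 * j + ones e + ones b)) (sym degree≡0)
    (almost-add j {d = 0} {a = (t + 1) ^ 3} {c = ones e} (scaled≤ j (≮⇒≥ j≮K)) (ones≥1 b) lowest-bound))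

-- Comparison of the error and of δ(2) with the bound p/q.

-- With w = t - k this is (1 + 1/t)^k ≤ 1/(1 - k/t). In the induction t stays fixed while `w` grows
-- as `k` shrinks.
bernoulli : ∀ k w → let t = k + w in (t + 1) ^ k * w ≤ t ^ k * t
bernoulli zero w = ≤-refl
bernoulli (suc k) w = begin
  (t + 1) * (t + 1) ^ k * w        ≡⟨ lem₁ (t + 1) ((t + 1) ^ k) w ⟩
  (t + 1) ^ k * ((t + 1) * w)      ≡⟨ cong ((t + 1) ^ k *_) (lem₂ t w) ⟩
  (t + 1) ^ k * (t * w + w)        ≤⟨ *-monoʳ-≤ ((t + 1) ^ k) (+-monoʳ-≤ (t * w) (m≤n+m w (suc k))) ⟩
  (t + 1) ^ k * (t * w + t)        ≡⟨ lem₃ ((t + 1) ^ k) t w ⟩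
  t * ((t + 1) ^ k * suc w)        ≤⟨ *-monoʳ-≤ t (subst (λ u → (u + 1) ^ k * suc w ≤ u ^ k * u) (+-suc k w) (bernoulli k (suc w))) ⟩
  t * (t ^ k * t)                  ≡⟨ *-assoc t (t ^ k) t ⟨
  t * t ^ k * t                    ∎
  where
  open ≤-Reasoning
  t : ℕ
  t = suc k + w
  lem₁ : ∀ a b c → a * b * c ≡ b * (a * c)
  lem₁ = solve-∀
  lem₂ : ∀ a b → (a + 1) * b ≡ a * b + b
  lem₂ = solve-∀
  lem₃ : ∀ a b c → a * (b * c + b) ≡ b * (a * (1 + c))
  lem₃ = solve-∀

power-ratio : ∀ k .{{_ : NonZero k}} → let t = k + k in (t + 1) ^ k ≤ 2 * t ^ k
power-ratio k = *-cancelʳ-≤ _ _ k (≤-trans (bernoulli k k) (≤-reflexive (lem ((k + k) ^ k) k)))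
  where
  lem : ∀ a b → a * (b + b) ≡ 2 * a * b
  lem = solve-∀

DefectBelowWith : (p q n c : ℕ) → Set
DefectBelowWith p q n c = 3 ^ (q * c) < 3 ^ p * n ^ (3 * q)

-- From p + 1 ≤ d q there is a factor 3 to spare after raising to the power q, while the error (1 +
-- 1/t)^(3q) is at most 2 by `power-ratio`, as t = 6q.
almost⇒¬below : ∀ p q .{{_ : NonZero q}} d {n c} → p < d * q → AlmostDefect≥ (3 * q + 3 * q) 0 d n c →
  ¬ DefectBelowWith p q n c
almost⇒¬below p q d {n} {c} p<dq almost below = <-irrefl refl (begin-strict
  2 * t ^ k * 3 ^ (q * c)                <⟨ *-monoʳ-< (2 * t ^ k) {{m*n≢0 2 (t ^ k) {{_}} {{m^n≢0 t k {{t≢0}}}}}} below ⟩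
  2 * t ^ k * (3 ^ p * n ^ k)            ≤⟨ *-monoˡ-≤ (3 ^ p * n ^ k) (*-monoˡ-≤ (t ^ k) (n≤1+n 2)) ⟩
  3 * t ^ k * (3 ^ p * n ^ k)            ≡⟨ lem (t ^ k) (3 ^ p) (n ^ k) ⟩
  n ^ k * t ^ k * 3 ^ suc p              ≤⟨ *-monoʳ-≤ (n ^ k * t ^ k) (^-monoʳ-≤ 3 p<dq) ⟩
  n ^ k * t ^ k * 3 ^ (d * q)            ≡⟨ cong₂ _*_ (sym (^-distribʳ-* k n t)) (sym (^-*-assoc 3 d q)) ⟩
  (n * t) ^ k * (3 ^ d) ^ q
    ≡⟨ cong (_* (3 ^ d) ^ q) (trans (cong (λ m → (m * t) ^ k) (sym (+-identityʳ n))) (sym (^-*-assoc _ 3 q))) ⟩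
  (((n + 0) * t) ^ 3) ^ q * (3 ^ d) ^ q  ≡⟨ ^-distribʳ-* q _ (3 ^ d) ⟨
  (((n + 0) * t) ^ 3 * 3 ^ d) ^ q        ≤⟨ ^-monoˡ-≤ q almost ⟩
  ((t + 1) ^ 3 * 3 ^ c) ^ q              ≡⟨ ^-distribʳ-* q ((t + 1) ^ 3) (3 ^ c) ⟩
  ((t + 1) ^ 3) ^ q * (3 ^ c) ^ q        ≡⟨ cong₂ _*_ (^-*-assoc (t + 1) 3 q) (trans (^-*-assoc 3 c q) (cong (3 ^_) (*-comm c q))) ⟩
  (t + 1) ^ k * 3 ^ (q * c)              ≤⟨ *-monoˡ-≤ (3 ^ (q * c)) (power-ratio k) ⟩
  2 * t ^ k * 3 ^ (q * c)                ∎)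
  where
  open ≤-Reasoning
  k t : ℕ
  k = 3 * q
  t = k + k
  instance
    k≢0 : NonZero k
    k≢0 = m*n≢0 3 q
  t≢0 : NonZero t
  t≢0 = >-nonZero (≤-trans (>-nonZero⁻¹ k) (m≤m+n k k))
  lem : ∀ a b c → 3 * a * (b * c) ≡ c * a * (3 * b)
  lem = solve-∀

-- Since p/q ≤ p, it suffices that 10 δ(2) ≥ 1, that is, 3 · 8^10 ≤ 9^10.
below⇒Below : ∀ p q .{{_ : NonZero q}} {n c} → DefectBelowWith p q n c → Below (10 * p) n c
below⇒Below p q {n} {c} below = begin-strict
  8 ^ (10 * p) * 3 ^ c              <⟨ *-monoʳ-< (8 ^ (10 * p)) {{m^n≢0 8 (10 * p)}} cubes ⟩
  8 ^ (10 * p) * (3 ^ p * n ^ 3)    ≡⟨ *-assoc (8 ^ (10 * p)) (3 ^ p) (n ^ 3) ⟨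
  8 ^ (10 * p) * 3 ^ p * n ^ 3      ≤⟨ *-monoˡ-≤ (n ^ 3) powers ⟩
  9 ^ (10 * p) * n ^ 3              ∎
  where
  open ≤-Reasoning
  powers : 8 ^ (10 * p) * 3 ^ p ≤ 9 ^ (10 * p)
  powers = begin
    8 ^ (10 * p) * 3 ^ p    ≡⟨ cong (_* 3 ^ p) (^-*-assoc 8 10 p) ⟨
    (8 ^ 10) ^ p * 3 ^ p    ≡⟨ ^-distribʳ-* p (8 ^ 10) 3 ⟨
    (8 ^ 10 * 3) ^ p        ≤⟨ ^-monoˡ-≤ p (toWitness {a? = 8 ^ 10 * 3 ≤? 9 ^ 10} _) ⟩
    (9 ^ 10) ^ p            ≡⟨ ^-*-assoc 9 10 p ⟩
    9 ^ (10 * p)            ∎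
  cubes : 3 ^ c < 3 ^ p * n ^ 3
  cubes = ≰⇒> λ h → <⇒≱ below (begin
    3 ^ p * n ^ (3 * q)             ≤⟨ *-monoˡ-≤ (n ^ (3 * q)) (^-monoʳ-≤ 3 (m≤m*n p q)) ⟩
    3 ^ (p * q) * n ^ (3 * q)       ≡⟨ cong₂ _*_ (^-*-assoc 3 p q) (^-*-assoc n 3 q) ⟨
    (3 ^ p) ^ q * (n ^ 3) ^ q       ≡⟨ ^-distribʳ-* q (3 ^ p) (n ^ 3) ⟨
    (3 ^ p * n ^ 3) ^ q             ≤⟨ ^-monoˡ-≤ q h ⟩
    (3 ^ c) ^ q                     ≡⟨ trans (^-*-assoc 3 c q) (cong (3 ^_) (*-comm c q)) ⟩
    3 ^ (q * c)                     ∎)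

-- Reduction to degree at most ⌊p/q⌋.

-- `R` is a parameter so that the notion serves both for a single pair, `Rep f`, and for a list,
-- `RepresentedIn S`.
LowDegreeCover : (p q : ℕ) .{{_ : NonZero q}} → (ℕ → ℕ → Set) → Set
LowDegreeCover p q R = Σ (List Tree) λ L → All (λ g → degree g ≤ p / q) L ×
  (∀ {n c} → R n c → DefectBelowWith p q n c → RepresentedIn L n c)

cover-list : ∀ p q .{{_ : NonZero q}} (S : List Tree) → (∀ f → f ∈ S → LowDegreeCover p q (Rep f)) →
  LowDegreeCover p q (RepresentedIn S)
cover-list p q [] _ = [] , [] , λ ()
cover-list p q (f ∷ S) covers =
  let L , degL , repL = covers f (here refl)
      M , degM , repM = cover-list p q S (λ g g∈ → covers g (there g∈))
  in L ++ M , All.++⁺ degL degM , λ where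
    (_ , here refl , r) below → let g , g∈ , rg = repL r below in g , ∈-++⁺ˡ g∈ , rg
    (g , there g∈ , r) below → let k , k∈ , rk = repM (g , g∈ , r) below in k , ∈-++⁺ʳ L k∈ , rk

n/m<d⇒n<d*m : ∀ n m .{{_ : NonZero m}} {d} → n / m < d → n < d * m
n/m<d⇒n<d*m n m {d} h = ≰⇒> λ dm≤n → <⇒≱ h (begin
  d            ≡⟨ m*n/n≡m d m ⟨
  d * m / m    ≤⟨ /-monoˡ-≤ m dm≤n ⟩
  n / m        ∎)
  where open ≤-Reasoning

-- `k` bounds the degree, which every truncation lowers by 1. As long as the degree exceeds ⌊p/q⌋,
-- the second alternative of `truncate` contradicts δ < p/q, so the list alone suffices.
cover : ∀ p q .{{_ : NonZero q}} k f → degree f ≤ k → LowDegreeCover p q (Rep f)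
cover p q k f h with degree f ≤? p / q
... | yes low = f ∷ [] , low ∷ [] , λ r _ → f , here refl , r
cover p q zero f h | no ¬low = contradiction (≤-trans h z≤n) ¬low
cover p q (suc k) f h | no ¬low =
  let L , degL , repL = truncate f (3 * q + 3 * q) 0 (inj₁ refl)
      M , degM , repM = cover-list p q L λ g g∈ →
        cover p q k g (≤-pred (≤-trans (≤-reflexive (All.lookup degL g∈)) h))
  in M , degM , λ r below → repM (choose below (repL r)) below
  where
  choose : ∀ {L n c} → DefectBelowWith p q n c →
    RepresentedIn L n c ⊎ AlmostDefect≥ (3 * q + 3 * q) 0 (degree f) n c → RepresentedIn L n c
  choose _ (inj₁ r) = r
  choose below (inj₂ almost) =
    contradiction below (almost⇒¬below p q (degree f) (n/m<d⇒n<d*m p q (≰⇒> ¬low)) almost)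

-- From trees to low-defect pairs.

-- The expressions need not be most efficient: the rules admit every cost that is at least the
-- complexity.
toLDP : (f : Tree) → LDP (degree f) (base f)
toLDP (con e) = let c , ck , c≤ = complexity-exists e in const (eval e) (ones e) c (eval≥1 e) ck c≤
toLDP (f ⊗ g) = tensor (toLDP f) (toLDP g)
toLDP (f ·x+ b) = let d , dk , d≤ = complexity-exists b in addVar (toLDP f) (eval b) (ones b) d (eval≥1 b) dk d≤

toPair : Tree → Pair
toPair f = pair (degree f) (base f) (toLDP f)

take-++ : ∀ {A : Set} {m n} (xs : Vec A m) (ys : Vec A n) → Vec.take m (xs Vec.++ ys) ≡ xs
take-++ {m = m} xs ys = ++-injectiveˡ _ xs (take++drop≡id m (xs Vec.++ ys))

drop-++ : ∀ {A : Set} {m n} (xs : Vec A m) (ys : Vec A n) → Vec.drop m (xs Vec.++ ys) ≡ ys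
drop-++ {m = m} xs ys = ++-injectiveʳ (Vec.take m (xs Vec.++ ys)) xs (take++drop≡id m (xs Vec.++ ys))

sum-∷ʳ : ∀ {n} (xs : Vec ℕ n) x → Vec.sum (xs Vec.∷ʳ x) ≡ Vec.sum xs + x
sum-∷ʳ Vec.[] x = +-identityʳ x
sum-∷ʳ (y Vec.∷ xs) x = trans (cong (y +_) (sum-∷ʳ xs x)) (sym (+-assoc y (Vec.sum xs) x))

rep⇒substitution : ∀ {f n c} → Rep f n c →
  Σ (Vec ℕ (degree f)) λ ns → poly (toLDP f) (Vec.map (3 ^_) ns) ≡ n × base f + 3 * Vec.sum ns ≡ c
rep⇒substitution (con e) = Vec.[] , refl , +-identityʳ (ones e)
rep⇒substitution (ten {f} {g} rf rg) with rep⇒substitution rf | rep⇒substitution rg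
... | xs , refl , refl | ys , refl , refl = xs Vec.++ ys ,
  cong₂ (λ us vs → poly (toLDP f) us * poly (toLDP g) vs)
    (trans (cong (Vec.take (degree f)) (map-++ (3 ^_) xs ys)) (take-++ (Vec.map (3 ^_) xs) _))
    (trans (cong (Vec.drop (degree f)) (map-++ (3 ^_) xs ys)) (drop-++ (Vec.map (3 ^_) xs) _)) ,
  trans (cong (λ s → base f + base g + 3 * s) (sum-++ xs)) (lem (base f) (base g) (Vec.sum xs) (Vec.sum ys))
  where
  lem : ∀ a b x y → a + b + 3 * (x + y) ≡ a + 3 * x + (b + 3 * y)
  lem = solve-∀
rep⇒substitution (add {f} {b} j rf) with rep⇒substitution rf
-- `addVar` multiplies by the last variable, so the exponent is appended at the end.
... | xs , refl , refl = xs Vec.∷ʳ j ,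
  cong (_+ eval b) (trans
    (cong₂ (λ us u → poly (toLDP f) us * u)
      (trans (cong Vec.init (map-∷ʳ (3 ^_) j xs)) (init-∷ʳ (3 ^ j) (Vec.map (3 ^_) xs)))
      (trans (cong Vec.last (map-∷ʳ (3 ^_) j xs)) (last-∷ʳ (3 ^ j) (Vec.map (3 ^_) xs))))
    (*-comm _ (3 ^ j))) ,
  trans (cong (λ s → base f + ones b + 3 * s) (sum-∷ʳ xs j)) (lem (base f) (ones b) (Vec.sum xs) j)
  where
  lem : ∀ a b x j → a + b + 3 * (x + j) ≡ 3 * j + (a + 3 * x) + b
  lem = solve-∀

rep⇒effRep : ∀ {f n c} → IsComplexity n c → Rep f n c → EffRep (toPair f) n
rep⇒effRep ck r = let ns , p , q = rep⇒substitution r in ns , p , subst (IsComplexity _) (sym q) ck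

theorem4p10 : (p q : ℕ) → .{{_ : NonZero q}} →
    Σ (List Pair) λ S →
    All (λ P → deg P ≤ p / q) S ×
    (∀ N → InB p q N → Any (λ P → EffRep P N) S)
theorem4p10 p q =
  -- `S` disregards degrees; `cover` then replaces each member by finitely many of degree at most
  -- ⌊p/q⌋.
  let S = build (10 * p)
      L , degL , repL = cover-list p q S λ f _ → cover p q (degree f) f ≤-refl
  in map toPair L , All.map⁺ degL , λ where
    N (leader , c , ck , below) →
      let f , f∈ , r = repL (build-represents (10 * p) ck (leader⇒tripling-free ck leader) (below⇒Below p q below)) below
      in lose (∈-map⁺ toPair f∈) (rep⇒effRep ck r)
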